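{- Let $m \ge 1$ be odd and $n \ge 4$ be even. The honeycomb toroidal graph $\mathrm{HTG}(m,n,1)$ is 2-spanning cyclable if and only if $m \geq 3$ and $n > 4$.
   Context: For integers $m\ge 1$, $\ell\ge 0$ and $n\ge 4$ with $n$ even and $m-\ell$ even, the honeycomb toroidal graph $\mathrm{HTG}(m,n,\ell)$ is the simple graph with vertex set $\{u_{i,j}: 0\le i\le m-1,\ 0\le j\le n-1\}$ (first subscript computed modulo $m$, second modulo $n$) whose edge set is the set of the following unordered pairs: $\{u_{i,j},u_{i,j+1}\}$ for all $i,j$ (vertical edges); $\{u_{i,j},u_{i+1,j}\}$ for all $0\le i\le m-2$ with $i+j$ odd (flat edges); and $\{u_{m-1,j},u_{0,j+\ell}\}$ for all $j$ having the same parity as $m$ (and $\ell$) (jump edges). (Repeated pairs give a single edge; thus $\mathrm{HTG}(1,n,1)$ is the $n$-cycle.) A 2-factor of a graph is a spanning subgraph in which every vertex has valency 2. A graph $X$ is 2-spanning cyclable if for every pair of distinct vertices $u,v$ of $X$ there is a 2-factor of $X$ consisting of exactly two cycles such that $u$ and $v$ lie in different cycles. -}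

module Defs where

open import Data.Nat using (ℕ; suc; _+_; _*_; _≤_; _<_)
open import Data.Nat.Divisibility using (_∣_)
open import Data.Fin using (Fin; toℕ)
open import Data.Product using (_×_; _,_; Σ; ∃)
open import Data.Sum using (_⊎_)
open import Data.List using (List; []; _∷_; _++_; [_]; length)
open import Data.List.Membership.Propositional using (_∈_)
open import Data.List.Relation.Unary.Unique.Propositional using (Unique)
open import Data.List.Relation.Unary.Linked using (Linked)
open import Data.Empty using (⊥)
open import Relation.Nullary using (¬_)
open import Relation.Binary.PropositionalEquality using (_≡_; _≢_)

_≡_[mod_] : ℕ → ℕ → ℕ → Set
a ≡ b [mod n ] = Σ ℕ (λ k → (a ≡ b + k * n) ⊎ (b ≡ a + k * n))

Vertex : ℕ → ℕ → Set
Vertex m n = Fin m × Fin n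

data HTGEdge (m n ℓ : ℕ) : Vertex m n → Vertex m n → Set where
  vertical : ∀ {i j j'} → (toℕ j + 1) ≡ toℕ j' [mod n ] →
             HTGEdge m n ℓ (i , j) (i , j')
  flat     : ∀ {i i' j} → suc (toℕ i) ≡ toℕ i' → ¬ (2 ∣ (toℕ i + toℕ j)) →
             HTGEdge m n ℓ (i , j) (i' , j)
  jump     : ∀ {i i' j j'} → suc (toℕ i) ≡ m → toℕ i' ≡ 0 →
             2 ∣ (toℕ j + m) → (toℕ j + ℓ) ≡ toℕ j' [mod n ] →
             HTGEdge m n ℓ (i , j) (i' , j')

HTGAdj : (m n ℓ : ℕ) → Vertex m n → Vertex m n → Set
HTGAdj m n ℓ u v = u ≢ v × (HTGEdge m n ℓ u v ⊎ HTGEdge m n ℓ v u)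

IsCycle : {V : Set} → (V → V → Set) → List V → Set
IsCycle Adj [] = ⊥
IsCycle Adj (x ∷ xs) =
  (3 ≤ length (x ∷ xs)) × Unique (x ∷ xs) × Linked Adj ((x ∷ xs) ++ [ x ])

TwoCycleFactorSeparating : {V : Set} → (V → V → Set) → V → V → Set
TwoCycleFactorSeparating {V} Adj u v =
  Σ (List V) λ C₁ → Σ (List V) λ C₂ →
    IsCycle Adj C₁ × IsCycle Adj C₂ ×
    Unique (C₁ ++ C₂) × (∀ w → w ∈ (C₁ ++ C₂)) ×
    u ∈ C₁ × v ∈ C₂

TwoSpanningCyclable : {V : Set} → (V → V → Set) → Set
TwoSpanningCyclable {V} Adj = ∀ (u v : V) → u ≢ v → TwoCycleFactorSeparating Adj u v

{-# OPTIONS --safe #-}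

-- For ℓ = 1 a walk once around the columns climbs one row, so writing k = i + j m for u_{i,j} turns
-- HTG(m,n,1) into the graph on ℤ/mn in which k is joined to k ± m, and every odd k to k + 1. Even
-- translations act on it, and after deleting a hexagon two columns become paths while each of the
-- other m − 2 columns can be cut at the same two places; joining the pieces left and right in zigzag
-- gives a Hamiltonian cycle of the rest. So it suffices to find, for two distinct vertices, a hexagon
-- containing exactly one of them.
--
-- Conversely, for m = 1 the graph is a cycle, and for n = 4 a separation of the adjacent vertices
-- (0,1) and (1,1) forces the two cycles to be columns 0 and 1, missing column 2.
module Submission where

open import Defs
open import Data.Nat using (ℕ; zero; suc; _+_; _*_; _∸_; _≤_; _<_; z≤n; s≤s; s≤s⁻¹; NonZero; _%_; _/_)
open import Data.Nat.Properties
open import Data.Nat.DivMod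
open import Data.Nat.Divisibility
open import Data.Nat.Tactic.RingSolver using (solve-∀)
open import Data.Product using (_×_; _,_; Σ; ∃; ∃₂; proj₁; proj₂)
open import Data.Product.Properties using (≡-dec)
open import Data.Sum using (_⊎_; inj₁; inj₂; [_,_]′; swap; reduce)
open import Data.Fin using (Fin; toℕ)
open import Data.Fin.Patterns using (0F; 1F; 2F; 3F)
import Data.Fin.Properties as Fin
open import Data.List using (List; []; _∷_; _++_; [_]; length; reverse; map; allFin; cartesianProduct; initLast; _∷ʳ′_)
open import Data.List.Properties using (++-assoc; unfold-reverse; length-++; length-map; length-tabulate; length-reverse; map-++)
open import Data.List.Membership.Propositional using (_∈_; _∉_)
open import Data.List.Membership.Propositional.Properties
import Data.List.Membership.DecPropositional as DecMembership
open import Data.List.Relation.Unary.Any using (here; there)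
open import Data.List.Relation.Unary.Any.Properties using (reverse⁺; reverse⁻)
open import Data.List.Relation.Unary.All as All using (All; []; _∷_)
open import Data.List.Relation.Unary.AllPairs using ([]; _∷_)
open import Data.List.Relation.Unary.Unique.Propositional using (Unique)
open import Data.List.Relation.Unary.Unique.Propositional.Properties using (cartesianProduct⁺; allFin⁺; Unique[x∷xs]⇒x∉xs)
open import Data.List.Relation.Unary.Linked using (Linked; []; [-]; _∷_)
open import Data.List.Relation.Binary.Permutation.Propositional using (_↭_; ↭-refl; ↭-sym; ↭-trans; prep; ↭⇒↭ₛ)
open import Data.List.Relation.Binary.Permutation.Propositional.Properties using (∈-resp-↭; ↭-length; shift; ++-comm)
import Data.List.Relation.Binary.Permutation.Setoid.Properties as ↭ₛ
open import Data.Empty using (⊥; ⊥-elim)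
open import Function using (_∘_)
open import Function.Bundles using (_⇔_; mk⇔)
open import Relation.Nullary using (¬_; Dec; yes; no)
open import Relation.Binary.PropositionalEquality using (_≡_; _≢_; refl; sym; trans; cong; cong₂; subst; setoid; module ≡-Reasoning)

-- Duplicate-free lists and distinctness by counting

module _ {A : Set} where

  Unique-resp-↭ : {xs ys : List A} → xs ↭ ys → Unique xs → Unique ys
  Unique-resp-↭ p = ↭ₛ.Unique-resp-↭ (setoid A) (↭⇒↭ₛ p)

  Unique-++⁻ : ∀ (xs : List A) {ys} → Unique (xs ++ ys) → Unique xs × Unique ys
  Unique-++⁻ []       u       = [] , u
  Unique-++⁻ (x ∷ xs) (p ∷ u) with Unique-++⁻ xs u
  ... | ux , uy = All.tabulate (λ q → All.lookup p (∈-++⁺ˡ q)) ∷ ux , uy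

  Unique-++-disjoint : ∀ (xs : List A) {ys z} → Unique (xs ++ ys) → z ∈ xs → z ∉ ys
  Unique-++-disjoint (x ∷ xs) (p ∷ u) (here refl) q = All.lookup p (∈-++⁺ʳ xs q) refl
  Unique-++-disjoint (x ∷ xs) (p ∷ u) (there r)   q = Unique-++-disjoint xs u r q

  -- Delete `x` from `ys`: as `x` does not recur in `xs`, the other entries of `xs` are still found
  -- in what is left, and the lengths stay equal.
  covering⇒↭ : ∀ (xs : List A) {ys} → Unique xs → (∀ {x} → x ∈ xs → x ∈ ys) →
               length ys ≡ length xs → xs ↭ ys
  covering⇒↭ [] {[]} _ _ _ = ↭-refl
  covering⇒↭ (x ∷ xs) u@(_ ∷ u′) sub len with ∈-∃++ (sub (here refl))
  ... | ys₁ , ys₂ , refl =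
    ↭-trans (prep x (covering⇒↭ xs u′ sub′ len′)) (↭-sym (shift x ys₁ ys₂))
    where
    sub′ : ∀ {y} → y ∈ xs → y ∈ ys₁ ++ ys₂
    sub′ y∈ with ∈-resp-↭ (shift x ys₁ ys₂) (sub (there y∈))
    ... | here refl = ⊥-elim (Unique[x∷xs]⇒x∉xs u y∈)
    ... | there q   = q
    len′ : length (ys₁ ++ ys₂) ≡ length xs
    len′ = suc-injective (trans (sym (↭-length (shift x ys₁ ys₂))) len)

length-product : ∀ {A B : Set} (xs : List A) (ys : List B) →
                 length (cartesianProduct xs ys) ≡ length xs * length ys
length-product []       ys = refl
length-product (x ∷ xs) ys = trans (length-++ (map (x ,_) ys))
  (cong₂ _+_ (length-map (x ,_) ys) (length-product xs ys))

-- A list of length `m * n` that meets all `m * n` vertices has no room for a repetition. This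
-- yields simplicity and disjointness of both cycles at once, without comparing their entries.
covering⇒unique : ∀ {m n} (L : List (Vertex m n)) → (∀ w → w ∈ L) →
                  length L ≡ m * n → Unique L
covering⇒unique {m} {n} L cov len =
  Unique-resp-↭ (covering⇒↭ vertices unique (λ _ → cov _) (trans len (sym size))) unique
  where
  vertices : List (Vertex m n)
  vertices = cartesianProduct (allFin m) (allFin n)
  unique : Unique vertices
  unique = cartesianProduct⁺ (allFin⁺ m) (allFin⁺ n)
  size : length vertices ≡ m * n
  size = trans (length-product (allFin m) (allFin n))
    (cong₂ _*_ (length-tabulate {n = m} (λ i → i)) (length-tabulate {n = n} (λ i → i)))

-- Linked lists and cycles

module _ {A : Set} {R : A → A → Set} where

  Linked-split : ∀ xs {x ys} → Linked R (xs ++ x ∷ ys) → Linked R (xs ++ [ x ]) × Linked R (x ∷ ys)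
  Linked-split []           l       = [-] , l
  Linked-split (a ∷ [])     (r ∷ l) = r ∷ [-] , l
  Linked-split (a ∷ b ∷ xs) (r ∷ l) with Linked-split (b ∷ xs) l
  ... | l₁ , l₂ = r ∷ l₁ , l₂

  Linked-join : ∀ xs {x ys} → Linked R (xs ++ [ x ]) → Linked R (x ∷ ys) → Linked R (xs ++ x ∷ ys)
  Linked-join []           _       l = l
  Linked-join (a ∷ [])     (r ∷ _) l = r ∷ l
  Linked-join (a ∷ b ∷ xs) (r ∷ k) l = r ∷ Linked-join (b ∷ xs) k l

  Linked-last : ∀ xs {x y} → Linked R (xs ++ x ∷ y ∷ []) → R x y
  Linked-last xs l with Linked-split xs l
  ... | _ , r ∷ _ = r

  -- Cut the cycle in front of `x` and exchange the two pieces; the old closing edge becomes the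
  -- seam.
  rotate : ∀ {C x} → IsCycle R C → x ∈ C → Σ (List A) λ D → IsCycle R (x ∷ D) × C ↭ x ∷ D
  rotate {C} {x} cyc x∈C with ∈-∃++ x∈C
  ... | [] , Q , refl = Q , cyc , ↭-refl
  ... | c ∷ P , Q , refl with cyc
  ...   | len , u , l = Q ++ c ∷ P , (subst (3 ≤_) (↭-length perm) len , Unique-resp-↭ perm u , linked) , perm
    where
    perm : c ∷ P ++ x ∷ Q ↭ x ∷ Q ++ c ∷ P
    perm = ++-comm (c ∷ P) (x ∷ Q)
    pieces : Linked R ((c ∷ P) ++ [ x ]) × Linked R (x ∷ Q ++ [ c ])
    pieces = Linked-split (c ∷ P) (subst (λ L → Linked R (c ∷ L)) (++-assoc P (x ∷ Q) [ c ]) l)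
    linked : Linked R ((x ∷ Q ++ c ∷ P) ++ [ x ])
    linked = subst (λ L → Linked R (x ∷ L)) (sym (++-assoc Q (c ∷ P) [ x ]))
      (Linked-join (x ∷ Q) (proj₂ pieces) (proj₁ pieces))

  module _ (R-sym : ∀ {x y} → R x y → R y x) where

    -- Rotated to begin at `x`, the cycle has `x` adjacent to its second and its last entry, which
    -- are different entries because the length is at least 3.
    two-neighbours : ∀ {C x} → IsCycle R C → x ∈ C →
      ∃₂ λ a b → a ≢ b × (a ∈ C × R x a) × (b ∈ C × R x b)
    two-neighbours {C} {x} cyc x∈C with rotate cyc x∈C
    ... | D , (len , u , l) , perm with D | len | u | l
    ...   | [] | s≤s () | _ | _
    ...   | a ∷ D′ | len′ | u′ | l′ with initLast D′
    ...     | [] with len′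
    ...       | s≤s (s≤s ())
    two-neighbours {C} {x} cyc x∈C | D , _ , perm | a ∷ D′ | len′ | _ ∷ (a∉ ∷ _) | (ra ∷ l′) | E ∷ʳ′ b =
      a , b , All.lookup a∉ (∈-++⁺ʳ E (here refl)) ,
      (∈-resp-↭ (↭-sym perm) (there (here refl)) , ra) ,
      (∈-resp-↭ (↭-sym perm) (there (there (∈-++⁺ʳ E (here refl)))) ,
       R-sym (Linked-last (a ∷ E) (subst (λ L → Linked R (a ∷ L)) (++-assoc E [ b ] [ x ]) l′)))

-- Paths with their vertex lists

data Path {A : Set} (R : A → A → Set) : A → A → List A → Set where
  stop : ∀ {a} → Path R a a [ a ]
  _◅_  : ∀ {a b c L} → R a b → Path R b c L → Path R a c (a ∷ L)

infixr 5 _◅_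

module _ {A : Set} {R : A → A → Set} where

  join : ∀ {a b c d L K} → Path R a b L → R b c → Path R c d K → Path R a d (L ++ K)
  join stop    r q = r ◅ q
  join (s ◅ p) r q = s ◅ join p r q

  reversed : (∀ {x y} → R x y → R y x) → ∀ {a b L} → Path R a b L → Path R b a (reverse L)
  reversed s stop = stop
  reversed s {a} (_◅_ {L = L} r p) =
    subst (Path R _ _) (sym (unfold-reverse a L)) (join (reversed s p) (s r) stop)

  linked : ∀ {a b c L} → Path R a b L → R b c → Linked R (L ++ [ c ])
  linked stop r = r ∷ [-]
  linked (s ◅ stop) r = s ∷ r ∷ [-]
  linked (s ◅ p@(_ ◅ _)) r = s ∷ linked p r

  closed : ∀ {a b L} → Path R a b L → R b a → 3 ≤ length L → Unique L → IsCycle R L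
  closed p@stop    r len u = len , u , linked p r
  closed p@(_ ◅ _) r len u = len , u , linked p r

image : ∀ {A B : Set} {S : A → A → Set} {R : B → B → Set} (f : A → B) →
        (∀ {x y} → S x y → R (f x) (f y)) →
        ∀ {a b L} → Path S a b L → Path R (f a) (f b) (map f L)
image f r stop    = stop
image f r (e ◅ p) = r e ◅ image f r p

separating-sym : ∀ {V : Set} {R : V → V → Set} {u v} →
  TwoCycleFactorSeparating R u v → TwoCycleFactorSeparating R v u
separating-sym (C₁ , C₂ , c₁ , c₂ , uniq , cov , u∈ , v∈) =
  C₂ , C₁ , c₂ , c₁ , Unique-resp-↭ (++-comm C₁ C₂) uniq ,
  (λ w → ∈-resp-↭ (++-comm C₁ C₂) (cov w)) , v∈ , u∈

HTGAdj-sym : ∀ {m n ℓ u v} → HTGAdj m n ℓ u v → HTGAdj m n ℓ v u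
HTGAdj-sym (ne , e) = ne ∘ sym , swap e

-- Residues and digits

toℕ-mod : ∀ a n .{{_ : NonZero n}} → toℕ (a mod n) ≡ a % n
toℕ-mod a n = Fin.toℕ-fromℕ< (m%n<n a n)

mod-cong : ∀ a b n .{{_ : NonZero n}} → a % n ≡ b % n → a mod n ≡ b mod n
mod-cong a b n eq = Fin.toℕ-injective (trans (toℕ-mod a n) (trans eq (sym (toℕ-mod b n))))

digit₀ : ∀ {i m} r .{{_ : NonZero m}} → i < m → (i + r * m) % m ≡ i
digit₀ {i} {m} r i<m = trans ([m+kn]%n≡m%n i r m) (m<n⇒m%n≡m i<m)

digit₁ : ∀ {i m} r .{{_ : NonZero m}} → i < m → (i + r * m) / m ≡ r
digit₁ {i} {m} r i<m = trans (+-distrib-/-∣ʳ i (n∣m*n r))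
  (cong₂ _+_ (m<n⇒m/n≡0 i<m) (m*n/n≡m r m))

digits-unique : ∀ {i i′ m} r r′ .{{_ : NonZero m}} → i < m → i′ < m →
                i + r * m ≡ i′ + r′ * m → i ≡ i′ × r ≡ r′
digits-unique {m = m} r r′ i<m i′<m eq =
  trans (sym (digit₀ r i<m)) (trans (cong (_% m) eq) (digit₀ r′ i′<m)) ,
  trans (sym (digit₁ r i<m)) (trans (cong (_/ m) eq) (digit₁ r′ i′<m))

suc-mod : ∀ a n .{{_ : NonZero n}} → (toℕ (a mod n) + 1) ≡ toℕ (suc a mod n) [mod n ]
suc-mod a n = suc (a % n) / n , inj₁ (begin
  toℕ (a mod n) + 1                             ≡⟨ cong (_+ 1) (toℕ-mod a n) ⟩
  a % n + 1                                     ≡⟨ +-comm (a % n) 1 ⟩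
  suc (a % n)                                   ≡⟨ m≡m%n+[m/n]*n (suc (a % n)) n ⟩
  suc (a % n) % n + suc (a % n) / n * n         ≡⟨ cong (_+ suc (a % n) / n * n) (sym suc-%) ⟩
  suc a % n + suc (a % n) / n * n               ≡⟨ cong (_+ suc (a % n) / n * n) (sym (toℕ-mod (suc a) n)) ⟩
  toℕ (suc a mod n) + suc (a % n) / n * n       ∎)
  where
  open ≡-Reasoning
  suc-% : suc a % n ≡ suc (a % n) % n
  suc-% = trans (cong (λ b → suc b % n) (m≡m%n+[m/n]*n a n)) ([m+kn]%n≡m%n (suc (a % n)) (a / n) n)

∣⇒∤suc : ∀ {d k} → 2 ≤ d → d ∣ k → ¬ d ∣ suc k
∣⇒∤suc {d} {k} 2≤d d∣k d∣1+k =
  <-irrefl refl (≤-trans 2≤d (∣⇒≤ (∣m+n∣m⇒∣n (subst (d ∣_) (+-comm 1 k) d∣1+k) d∣k)))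

suc-mod-≢ : ∀ a n .{{_ : NonZero n}} → 2 ≤ n → a mod n ≢ suc a mod n
suc-mod-≢ a n 2≤n eq = ∣⇒∤suc 2≤n (m%n≡0⇒n∣m _ n zero-rem) (m%n≡0⇒n∣m _ n suc-rem)
  where
  -- `b` is `a` raised to a multiple of `n`. If `a` and `suc a` agreed modulo `n`, then `n` would
  -- divide both `b` and `suc b`.
  b : ℕ
  b = n ∸ a % n + a
  eq% : a % n ≡ suc a % n
  eq% = trans (sym (toℕ-mod a n)) (trans (cong toℕ eq) (toℕ-mod (suc a) n))
  zero-rem : b % n ≡ 0
  zero-rem = begin
    b % n                                  ≡⟨ cong (λ c → (n ∸ a % n + c) % n) (m≡m%n+[m/n]*n a n) ⟩
    (n ∸ a % n + (a % n + a / n * n)) % n  ≡⟨ cong (_% n) (sym (+-assoc (n ∸ a % n) _ _)) ⟩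
    (n ∸ a % n + a % n + a / n * n) % n    ≡⟨ [m+kn]%n≡m%n _ (a / n) n ⟩
    (n ∸ a % n + a % n) % n                ≡⟨ cong (_% n) (m∸n+n≡m (m%n≤n a n)) ⟩
    n % n                                  ≡⟨ n%n≡0 n ⟩
    0                                      ∎
    where open ≡-Reasoning
  suc-rem : suc b % n ≡ 0
  suc-rem = begin
    suc b % n                              ≡⟨ cong (_% n) (sym (+-suc (n ∸ a % n) a)) ⟩
    (n ∸ a % n + suc a) % n                ≡⟨ %-distribˡ-+ (n ∸ a % n) (suc a) n ⟩
    ((n ∸ a % n) % n + suc a % n) % n      ≡⟨ cong (λ c → ((n ∸ a % n) % n + c) % n) (sym eq%) ⟩
    ((n ∸ a % n) % n + a % n) % n          ≡⟨ sym (%-distribˡ-+ (n ∸ a % n) a n) ⟩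
    b % n                                  ≡⟨ zero-rem ⟩
    0                                      ∎
    where open ≡-Reasoning

-- Numbering the vertices by integers modulo `m * n`

abstract
  π : ∀ {m n} .{{_ : NonZero m}} .{{_ : NonZero n}} → ℕ → Vertex m n
  π {m} {n} k = k mod m , (k / m) mod n

module _ {m n : ℕ} .{{_ : NonZero m}} .{{_ : NonZero n}} where

  abstract
    π-digits : ∀ {i} r → i < m → π {m} {n} (i + r * m) ≡ (i mod m , r mod n)
    π-digits {i} r i<m = cong₂ _,_
      (mod-cong _ i m ([m+kn]%n≡m%n i r m)) (cong (_mod n) (digit₁ r i<m))

    π-periodic : ∀ k q → π {m} {n} (k + q * (m * n)) ≡ π k
    π-periodic k q = cong₂ _,_
      (mod-cong _ k m (trans (cong (_% m) eq) ([m+kn]%n≡m%n k (q * n) m)))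
      (mod-cong _ (k / m) n (trans (cong (λ a → a / m % n) eq) (trans (cong (_% n) quot) ([m+kn]%n≡m%n (k / m) q n))))
      where
      eq : k + q * (m * n) ≡ k + q * n * m
      eq = identity k q m n
        where
        identity : ∀ k q m n → k + q * (m * n) ≡ k + q * n * m
        identity = solve-∀
      quot : (k + q * n * m) / m ≡ k / m + q * n
      quot = trans (+-distrib-/-∣ʳ k (n∣m*n (q * n))) (cong (k / m +_) (m*n/n≡m (q * n) m))

  index : Vertex m n → ℕ
  index (i , j) = toℕ i + toℕ j * m

  π-index : ∀ v → π (index v) ≡ v
  π-index (i , j) = trans (π-digits (toℕ j) (Fin.toℕ<n i)) (cong₂ _,_ (fix m i) (fix n j))
    where
    fix : ∀ d .{{_ : NonZero d}} (a : Fin d) → toℕ a mod d ≡ a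
    fix d a = Fin.toℕ-injective (trans (toℕ-mod (toℕ a) d) (m<n⇒m%n≡m (Fin.toℕ<n a)))

  abstract
    index-π : ∀ k → ∃ λ q → k ≡ index (π k) + q * (m * n)
    index-π k = k / m / n , (begin
      k                                               ≡⟨ m≡m%n+[m/n]*n k m ⟩
      k % m + k / m * m                               ≡⟨ cong (λ a → k % m + a * m) (m≡m%n+[m/n]*n (k / m) n) ⟩
      k % m + (k / m % n + k / m / n * n) * m         ≡⟨ regroup (k % m) (k / m % n) (k / m / n) m n ⟩
      k % m + k / m % n * m + k / m / n * (m * n)     ≡⟨ cong (_+ k / m / n * (m * n))
        (sym (cong₂ (λ a b → a + b * m) (toℕ-mod k m) (toℕ-mod (k / m) n))) ⟩
      index (π k) + k / m / n * (m * n)               ∎)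
      where
      open ≡-Reasoning
      regroup : ∀ a b c m n → a + (b + c * n) * m ≡ a + b * m + c * (m * n)
      regroup = solve-∀

  instance
    private
      mn≢0 : NonZero (m * n)
      mn≢0 = m*n≢0 m n

  -- Each number is an index plus a multiple of `N`. Adding the multiple of the other side to each
  -- turns the congruence into an equation, which the base-`N` digits decide.
  π-injective : ∀ b {d e} → d < m * n → e < m * n → π {m} {n} (b + d) ≡ π (b + e) → d ≡ e
  π-injective b {d} {e} d<N e<N eq with index-π (b + d) | index-π (b + e)
  ... | q , eqd | q′ , eqe =
    proj₁ (digits-unique q′ q d<N e<N (+-cancelˡ-≡ b _ _ (begin
      b + (d + q′ * N)                    ≡⟨ sym (+-assoc b d _) ⟩
      b + d + q′ * N                      ≡⟨ cong (_+ q′ * N) eqd ⟩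
      x + q * N + q′ * N                  ≡⟨ exchange x (q * N) (q′ * N) ⟩
      x + q′ * N + q * N                  ≡⟨ cong (λ v → index v + q′ * N + q * N) eq ⟩
      index (π (b + e)) + q′ * N + q * N  ≡⟨ cong (_+ q * N) (sym eqe) ⟩
      b + e + q * N                       ≡⟨ +-assoc b e _ ⟩
      b + (e + q * N)                     ∎)))
    where
    open ≡-Reasoning
    N x : ℕ
    N = m * n
    x = index (π (b + d))
    exchange : ∀ a c e → a + c + e ≡ a + e + c
    exchange = solve-∀

  π-surjective : ∀ b (v : Vertex m n) → ∃ λ e → e < m * n × π (b + e) ≡ v
  π-surjective b v = e , m%n<n y (m * n) , (begin
    π (b + e)                            ≡⟨ sym (π-periodic (b + e) (y / N)) ⟩
    π (b + e + y / N * N)                ≡⟨ cong π (+-assoc b e _) ⟩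
    π (b + (e + y / N * N))              ≡⟨ cong (λ z → π (b + z)) (sym (m≡m%n+[m/n]*n y N)) ⟩
    π (b + y)                            ≡⟨ cong π wrap ⟩
    π (index v + b * N)                  ≡⟨ π-periodic (index v) b ⟩
    π (index v)                          ≡⟨ π-index v ⟩
    v                                    ∎)
    where
    open ≡-Reasoning
    N y e : ℕ
    N = m * n
    -- The term `b * (N ∸ 1)` stands for minus `b` modulo `N`.
    y = index v + b * (N ∸ 1)
    e = y % N
    wrap : b + y ≡ index v + b * N
    wrap = trans (shuffle b (index v) (N ∸ 1)) (cong (λ a → index v + b * a) (m+[n∸m]≡n (>-nonZero⁻¹ N)))
      where
      shuffle : ∀ b i a → b + (i + b * a) ≡ i + b * (1 + a)
      shuffle = solve-∀
      >-nonZero⁻¹ : ∀ N .{{_ : NonZero N}} → 1 ≤ N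
      >-nonZero⁻¹ (suc N) = s≤s z≤n

  infix 4 _~_
  _~_ : ℕ → ℕ → Set
  a ~ b = HTGAdj m n 1 (π a) (π b)

  abstract
    vertical-step : 2 ≤ n → ∀ {a b} → b ≡ a + m → a ~ b
    vertical-step 2≤n {a} refl = subst (HTGAdj m n 1 (π a)) (sym up)
      ((λ eq → suc-mod-≢ (a / m) n 2≤n (cong proj₂ eq)) , inj₁ (vertical (suc-mod (a / m) n)))
      where
      up : π (a + m) ≡ (a mod m , suc (a / m) mod n)
      up = cong₂ _,_ (mod-cong _ a m ([m+n]%n≡m%n a m)) (cong (_mod n)
        (trans (+-distrib-/-∣ʳ a (∣-refl)) (trans (cong (a / m +_) (n/n≡1 m)) (+-comm (a / m) 1))))

    -- Since `m` is odd and `n` even, `i + j * m + q * (m * n)` has the parity of `i + j`; adding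
    -- `j * 2` exposes the even summand `j * suc m`.
    parity-π : 2 ∣ suc m → 2 ∣ n → ∀ {a} → 2 ∣ suc a →
               2 ∣ suc (toℕ (a mod m) + toℕ ((a / m) mod n))
    parity-π 2∣1+m 2∣n {a} odd with index-π a
    ... | q , eq = ∣m+n∣n⇒∣m
      (subst (2 ∣_) (trans (cong (λ b → suc b + j * 2) eq) (split i j m (q * (m * n)))) (∣m∣n⇒∣m+n odd (n∣m*n j)))
      (∣m∣n⇒∣m+n (∣n⇒∣m*n j 2∣1+m) (∣n⇒∣m*n q (∣n⇒∣m*n m 2∣n)))
      where
      i j : ℕ
      i = toℕ (a mod m)
      j = toℕ ((a / m) mod n)
      split : ∀ i j m c → suc (i + j * m + c) + j * 2 ≡ suc (i + j) + (j * suc m + c)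
      split = solve-∀
      ∣m+n∣n⇒∣m : ∀ {b c} → 2 ∣ b + c → 2 ∣ c → 2 ∣ b
      ∣m+n∣n⇒∣m {b} {c} p = ∣m+n∣m⇒∣n (subst (2 ∣_) (+-comm b c) p)

    -- Before the last column this is a flat edge. From the last column it is a jump edge: with
    -- `ℓ = 1` it lands in column 0 one row higher, which is the carry in `suc a`.
    flat-step : 1 < m → 2 ∣ suc m → 2 ∣ n → ∀ {a b} → 2 ∣ suc a → b ≡ suc a → a ~ b
    flat-step 1<m 2∣1+m 2∣n {a} odd refl with m≤n⇒m<n∨m≡n (m%n<n a m)
    ... | inj₁ lt = subst (HTGAdj m n 1 (π a)) (sym right)
      ((λ eq → 1+n≢n (sym (trans (sym (toℕ-mod a m)) (trans (cong (toℕ ∘ proj₁) eq) column)))) ,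
       inj₁ (flat (trans (cong suc (toℕ-mod a m)) (sym column))
         (λ even → ∣⇒∤suc ≤-refl even (parity-π 2∣1+m 2∣n odd))))
      where
      column : toℕ (suc (a % m) mod m) ≡ suc (a % m)
      column = trans (toℕ-mod _ m) (m<n⇒m%n≡m lt)
      right : π (suc a) ≡ (suc (a % m) mod m , (a / m) mod n)
      right = trans (cong (π ∘ suc) (m≡m%n+[m/n]*n a m)) (π-digits (a / m) lt)
    ... | inj₂ last = subst (HTGAdj m n 1 (π a)) (sym right)
      ((λ eq → <-irrefl (cong suc (trans (sym (trans (cong (toℕ ∘ proj₁) eq) column)) (toℕ-mod a m))) (subst (1 <_) (sym last) 1<m)) ,
       inj₁ (jump edge column
         -- In the last column `suc i` is `m`, so the evenness of `suc (i + j)` is the jump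
         -- condition on `j + m`.
         (subst (2 ∣_) (trans (cong (_+ toℕ ((a / m) mod n)) edge) (+-comm m _)) (parity-π 2∣1+m 2∣n odd))
         (suc-mod (a / m) n)))
      where
      edge : suc (toℕ (a mod m)) ≡ m
      edge = trans (cong suc (toℕ-mod a m)) last
      0<m : 0 < m
      0<m = <-trans (s≤s z≤n) 1<m
      column : toℕ (0 mod m) ≡ 0
      column = trans (toℕ-mod 0 m) (m<n⇒m%n≡m 0<m)
      right : π (suc a) ≡ (0 mod m , suc (a / m) mod n)
      right = trans (cong π (trans (cong suc (m≡m%n+[m/n]*n a m)) (cong (_+ a / m * m) last)))
        (π-digits (suc (a / m)) 0<m)

-- Sufficiency: edges between numbers, for `m = 3 + p * 2` and `n = 4 + h`

even-or-odd : ∀ k → 2 ∣ k ⊎ 2 ∣ suc k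
even-or-odd zero    = inj₁ (2 ∣0)
even-or-odd (suc k) with even-or-odd k
... | inj₁ even = inj₂ (∣m∣n⇒∣m+n ∣-refl even)
... | inj₂ odd  = inj₁ odd

module Factors (m p h′ : ℕ) .{{_ : NonZero m}} (m≡3+2p : m ≡ 3 + p * 2) (2∣h : 2 ∣ suc h′) where

  h n : ℕ
  h = suc h′
  n = 4 + h

  1<m : 1 < m
  1<m = subst (1 <_) (sym m≡3+2p) (s≤s (s≤s z≤n))

  2∣1+m : 2 ∣ suc m
  2∣1+m = subst (λ m → 2 ∣ suc m) (sym m≡3+2p) (n∣m*n (2 + p))

  2∣n : 2 ∣ n
  2∣n = ∣m∣n⇒∣m+n (n∣m*n 2) 2∣h

  Adj : Vertex m n → Vertex m n → Set
  Adj = HTGAdj m n 1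

  -- A record, so that the endpoints of an edge can be inferred.
  record E (a b : ℕ) : Set where
    constructor edge
    field adjacent : Adj (π a) (π b)
  open E

  E-sym : ∀ {a b} → E a b → E b a
  E-sym (edge e) = edge (HTGAdj-sym e)

  up : ∀ {a b} → b ≡ a + m → E a b
  up eq = edge (vertical-step (s≤s (s≤s z≤n)) eq)

  across : ∀ {a b} → 2 ∣ suc a → b ≡ suc a → E a b
  across odd eq = edge (flat-step 1<m 2∣1+m 2∣n odd eq)

  -- Columns and zigzags

  column : ℕ → ℕ → List ℕ
  column a zero    = [ a ]
  column a (suc r) = a ∷ column (a + m) r

  column-path : ∀ a r → Path E a (a + r * m) (column a r)
  column-path a zero    = subst (λ b → Path E a b [ a ]) (sym (+-identityʳ a)) stop
  column-path a (suc r) = up refl ◅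
    subst (λ b → Path E (a + m) b (column (a + m) r)) (+-assoc a m (r * m)) (column-path (a + m) r)

  column-∈ : ∀ a {i r} → i ≤ r → a + i * m ∈ column a r
  column-∈ a {zero}  {zero}  _ = here (+-identityʳ a)
  column-∈ a {zero}  {suc r} _ = here (+-identityʳ a)
  column-∈ a {suc i} {suc r} (s≤s le) =
    there (subst (_∈ column (a + m) r) (+-assoc a m (i * m)) (column-∈ (a + m) le))

  column-∈⁻ : ∀ a r {x} → x ∈ column a r → ∃ λ i → i ≤ r × x ≡ a + i * m
  column-∈⁻ a zero    (here refl) = 0 , z≤n , sym (+-identityʳ a)
  column-∈⁻ a (suc r) (here refl) = 0 , z≤n , sym (+-identityʳ a)
  column-∈⁻ a (suc r) (there x∈) with column-∈⁻ (a + m) r x∈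
  ... | i , i≤r , refl = suc i , s≤s i≤r , +-assoc a m (i * m)

  column-length : ∀ a r → length (column a r) ≡ suc r
  column-length a zero    = refl
  column-length a (suc r) = cong suc (column-length (a + m) r)

  -- Alternately up and down through `2k + 1` adjacent columns of `r + 1` vertices each; as their
  -- number is odd, the last one is climbed.
  zigzag : ℕ → ℕ → ℕ → List ℕ
  zigzag zero    a r = column a r
  zigzag (suc k) a r = column a r ++ reverse (column (suc a) r) ++ zigzag k (2 + a) r

  -- As `m` is odd, `a + r * m` has the parity of `a + r`. So a column piece of even height `suc r`
  -- that starts at an even number ends at an odd one, from which a step to the right is possible.
  top-odd : ∀ {a r} → 2 ∣ a → 2 ∣ suc r → 2 ∣ suc (a + r * m)
  top-odd {a} {r} even odd = ∣m+n∣m⇒∣n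
    (subst (2 ∣_) (identity a r m) (∣m∣n⇒∣m+n (∣m∣n⇒∣m+n even (∣m⇒∣m*n (suc m) odd)) ∣-refl))
    (∣m∣n⇒∣m+n odd 2∣1+m)
    where
    identity : ∀ a r m → a + suc r * suc m + 2 ≡ suc r + suc m + suc (a + r * m)
    identity = solve-∀

  zigzag-path : ∀ k {a r} → 2 ∣ a → 2 ∣ suc r → Path E a (a + k * 2 + r * m) (zigzag k a r)
  zigzag-path zero {a} {r} _ _ =
    subst (λ b → Path E a (b + r * m) (column a r)) (sym (+-identityʳ a)) (column-path a r)
  zigzag-path (suc k) {a} {r} even odd =
    subst (λ b → Path E a b (zigzag (suc k) a r)) (identity a (k * 2) (r * m))
      -- The odd top of column `a` leads right; column `suc a` is descended to its odd bottom, which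
      -- leads to `2 + a`.
      (join (column-path a r) (across (top-odd even odd) refl)
        (join (reversed E-sym (column-path (suc a) r))
          (across (∣m∣n⇒∣m+n ∣-refl even) refl)
          (zigzag-path k (∣m∣n⇒∣m+n ∣-refl even) odd)))
    where
    identity : ∀ a k r → 2 + a + k + r ≡ a + (2 + k) + r
    identity = solve-∀

  zigzag-∈ : ∀ k a {c i r} → c ≤ k * 2 → i ≤ r → a + c + i * m ∈ zigzag k a r
  zigzag-∈ zero a {zero} {i} {r} _ i≤r =
    subst (λ b → b + i * m ∈ column a r) (sym (+-identityʳ a)) (column-∈ a i≤r)
  zigzag-∈ (suc k) a {zero} {i} {r} _ i≤r =
    ∈-++⁺ˡ (subst (λ b → b + i * m ∈ column a r) (sym (+-identityʳ a)) (column-∈ a i≤r))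
  zigzag-∈ (suc k) a {suc zero} {i} {r} _ i≤r =
    ∈-++⁺ʳ (column a r) (∈-++⁺ˡ (subst (λ b → b + i * m ∈ reverse (column (suc a) r)) (+-comm 1 a) (reverse⁺ (column-∈ (suc a) i≤r))))
  zigzag-∈ (suc k) a {suc (suc c)} {i} {r} (s≤s (s≤s c≤)) i≤r =
    ∈-++⁺ʳ (column a r) (∈-++⁺ʳ (reverse (column (suc a) r))
      (subst (_∈ zigzag k (2 + a) r) (identity a c (i * m)) (zigzag-∈ k (2 + a) c≤ i≤r)))
    where
    identity : ∀ a c r → 2 + a + c + r ≡ a + (2 + c) + r
    identity = solve-∀

  zigzag-length : ∀ k a r → length (zigzag k a r) ≡ suc (k * 2) * suc r
  zigzag-length zero    a r = trans (column-length a r) (sym (+-identityʳ (suc r)))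
  zigzag-length (suc k) a r = trans (length-++ (column a r))
    (cong₂ _+_ (column-length a r) (trans (length-++ (reverse (column (suc a) r)))
      (cong₂ _+_ (trans (length-reverse (column (suc a) r)) (column-length (suc a) r)) (zigzag-length k (2 + a) r))))

  -- The hexagon and a cycle through its complement

  hexagon : ℕ → List ℕ
  hexagon s = column s 2 ++ reverse (column (suc s) 2)

  hexagon-path : ∀ {s} → 2 ∣ suc s → Path E s (suc s) (hexagon s)
  hexagon-path {s} odd = join (column-path s 2)
    (across (∣m∣n⇒∣m+n odd (∣m⇒∣m*n m ∣-refl)) refl)
    (reversed E-sym (column-path (suc s) 2))

  hexagon-∈ : ∀ s {c r} → c < 2 → r < 3 → s + (c + r * m) ∈ hexagon s
  hexagon-∈ s {zero}     {r} _ r<3 = ∈-++⁺ˡ (column-∈ s (s≤s⁻¹ r<3))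
  hexagon-∈ s {suc zero} {r} _ r<3 = ∈-++⁺ʳ (column s 2)
    (subst (_∈ reverse (column (suc s) 2)) (sym (+-suc s (r * m))) (reverse⁺ (column-∈ (suc s) (s≤s⁻¹ r<3))))
  hexagon-∈ s {suc (suc _)} (s≤s (s≤s ()))

  hexagon-∈⁻ : ∀ s {x} → x ∈ hexagon s → ∃₂ λ c r → c < 2 × r < 3 × x ≡ s + (c + r * m)
  hexagon-∈⁻ s x∈ with ∈-++⁻ (column s 2) x∈
  ... | inj₁ q with column-∈⁻ s 2 q
  ...   | r , r≤2 , eq = 0 , r , s≤s z≤n , s≤s r≤2 , eq
  hexagon-∈⁻ s x∈ | inj₂ q with column-∈⁻ (suc s) 2 (reverse⁻ q)
  ...   | r , r≤2 , eq = 1 , r , s≤s (s≤s z≤n) , s≤s r≤2 , trans eq (sym (+-suc s (r * m)))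

  -- Relative to `t`, the hexagon takes rows `h + 1` to `h + 3` of columns 0 and 1. The other
  -- `2p + 1` columns are cut between rows `h′` and `h` into blocks of heights `h` and 4, both even.
  -- The order is: column 0 upwards, the lower block backwards, column 1 upwards, the upper block
  -- forwards.
  complement : ℕ → List ℕ
  complement t = column t h ++ reverse (zigzag p (2 + t) h′) ++ column (suc t) h ++ zigzag p (2 + t + h * m) 3

  complement-path : ∀ {t} → 2 ∣ t → Path E t (2 + t + h * m + p * 2 + 3 * m) (complement t)
  complement-path {t} even =
    join (column-path t h) (E-sym (across lower-odd lower-end))
      (join (reversed E-sym (zigzag-path p (∣m∣n⇒∣m+n ∣-refl even) 2∣h))
        (E-sym (across (∣m∣n⇒∣m+n ∣-refl even) refl))
        (join (column-path (suc t) h) (across upper-even refl)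
          (zigzag-path p upper-even (n∣m*n 2))))
    where
    upper-even : 2 ∣ 2 + t + h * m
    upper-even = ∣m∣n⇒∣m+n (∣m∣n⇒∣m+n ∣-refl even) (∣m⇒∣m*n m 2∣h)
    lower-odd : 2 ∣ suc (2 + t + p * 2 + h′ * m)
    lower-odd = top-odd (∣m∣n⇒∣m+n (∣m∣n⇒∣m+n ∣-refl even) (n∣m*n p)) 2∣h
    -- Stepping right from the last column climbs a row, so the end of the lower block in row `h′`
    -- is joined to column 0 in row `h`.
    lower-end : t + h * m ≡ suc (2 + t + p * 2 + h′ * m)
    lower-end = trans (cong (λ m′ → t + (m′ + h′ * m)) m≡3+2p) (identity t (p * 2) (h′ * m))
      where
      identity : ∀ t p r → t + (3 + p + r) ≡ 3 + t + p + r
      identity = solve-∀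

  -- The upper block ends in the last column of the top row; its successor is `t + m * n`, which `π`
  -- identifies with `t`.
  complement-closes : ∀ {t} → 2 ∣ t → E (2 + t + h * m + p * 2 + 3 * m) t
  complement-closes {t} even = edge (subst (Adj _)
    (trans (cong π (around m m≡3+2p)) (π-periodic t 1))
    (adjacent (across (top-odd top-even (n∣m*n 2)) refl)))
    where
    top-even : 2 ∣ 2 + t + h * m + p * 2
    top-even = ∣m∣n⇒∣m+n (∣m∣n⇒∣m+n (∣m∣n⇒∣m+n ∣-refl even) (∣m⇒∣m*n m 2∣h)) (n∣m*n p)
    around : ∀ m → m ≡ 3 + p * 2 → suc (2 + t + h * m + p * 2 + 3 * m) ≡ t + 1 * (m * n)
    around _ refl = identity t p h
      where
      identity : ∀ t p h → suc (2 + t + h * (3 + p * 2) + p * 2 + 3 * (3 + p * 2)) ≡ t + 1 * ((3 + p * 2) * (4 + h))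
      identity = solve-∀

  -- The factor of two cycles

  module _ (t : ℕ) where

    s : ℕ
    s = t + suc h * m

    factor-∈-hexagon : ∀ {c r} → c < 2 → h < r → r < n → t + (c + r * m) ∈ hexagon s
    factor-∈-hexagon {c} {r} c<2 h<r r<n with m≤n⇒∃[o]m+o≡n h<r
    ... | i , refl = subst (_∈ hexagon s) (identity t c h i m) (hexagon-∈ s c<2
      (+-cancelˡ-< (suc h) i 3 (subst (suc h + i <_) (cong suc (+-comm 3 h)) r<n)))
      where
      identity : ∀ t c h i m → t + suc h * m + (c + i * m) ≡ t + (c + (suc h + i) * m)
      identity = solve-∀

    -- For `c ≥ 2` the comparison of `r` with `h` selects the lower or the upper zigzag; for `c < 2`
    -- it selects the column or the hexagon.
    factor-∈ : ∀ c r → c < m → r < n → t + (c + r * m) ∈ hexagon s ++ complement t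
    factor-∈ (suc (suc c)) r c<m r<n with s≤s⁻¹ (s≤s⁻¹ (subst (suc (suc c) <_) m≡3+2p c<m)) | ≤-<-connex h r
    ... | c<m′ | inj₂ (s≤s r≤h′) = ∈-++⁺ʳ (hexagon s) (∈-++⁺ʳ (column t h) (∈-++⁺ˡ (reverse⁺
      (subst (_∈ zigzag p (2 + t) h′) (identity t c (r * m)) (zigzag-∈ p (2 + t) (s≤s⁻¹ c<m′) r≤h′)))))
      where
      identity : ∀ t c r → 2 + t + c + r ≡ t + (2 + c + r)
      identity = solve-∀
    ... | c<m′ | inj₁ h≤r with m≤n⇒∃[o]m+o≡n h≤r
    ...   | i , refl = ∈-++⁺ʳ (hexagon s) (∈-++⁺ʳ (column t h) (∈-++⁺ʳ (reverse (zigzag p (2 + t) h′)) (∈-++⁺ʳ (column (suc t) h)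
      (subst (_∈ zigzag p (2 + t + h * m) 3) (identity t c h i m) (zigzag-∈ p (2 + t + h * m) (s≤s⁻¹ c<m′)
        (s≤s⁻¹ (+-cancelˡ-< h i 4 (subst (h + i <_) (+-comm 4 h) r<n))))))))
      where
      identity : ∀ t c h i m → 2 + t + h * m + c + i * m ≡ t + (2 + c + (h + i) * m)
      identity = solve-∀
    factor-∈ 0 r _ r<n with ≤-<-connex r h
    ... | inj₁ r≤h = ∈-++⁺ʳ (hexagon s) (∈-++⁺ˡ (column-∈ t r≤h))
    ... | inj₂ h<r = ∈-++⁺ˡ (factor-∈-hexagon (s≤s z≤n) h<r r<n)
    factor-∈ 1 r _ r<n with ≤-<-connex r h
    ... | inj₁ r≤h = ∈-++⁺ʳ (hexagon s) (∈-++⁺ʳ (column t h) (∈-++⁺ʳ (reverse (zigzag p (2 + t) h′)) (∈-++⁺ˡ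
      (subst (_∈ column (suc t) h) (sym (+-suc t (r * m))) (column-∈ (suc t) r≤h)))))
    ... | inj₂ h<r = ∈-++⁺ˡ (factor-∈-hexagon (s≤s (s≤s z≤n)) h<r r<n)

    C₁ C₂ : List (Vertex m n)
    C₁ = map π (hexagon s)
    C₂ = map π (complement t)

    factor-covers : ∀ w → w ∈ C₁ ++ C₂
    factor-covers w with π-surjective t w
    ... | e , e<N , refl = subst (π (t + e) ∈_) (map-++ π (hexagon s) (complement t))
      (∈-map⁺ π (subst (λ e → t + e ∈ hexagon s ++ complement t) (sym (m≡m%n+[m/n]*n e m))
        (factor-∈ (e % m) (e / m) (m%n<n e m) (m<n*o⇒m/o<n (subst (e <_) (*-comm m n) e<N)))))

    complement-length : length (complement t) ≡ suc h + (suc (p * 2) * h + (suc h + suc (p * 2) * 4))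
    complement-length = trans (length-++ (column t h)) (cong₂ _+_ (column-length t h)
      (trans (length-++ (reverse (zigzag p (2 + t) h′)))
        (cong₂ _+_ (trans (length-reverse (zigzag p (2 + t) h′)) (zigzag-length p (2 + t) h′))
          (trans (length-++ (column (suc t) h)) (cong₂ _+_ (column-length (suc t) h) (zigzag-length p _ 3))))))

    factor-length : length (C₁ ++ C₂) ≡ m * n
    factor-length = begin
      length (C₁ ++ C₂)                       ≡⟨ length-++ C₁ {C₂} ⟩
      6 + length C₂                           ≡⟨ cong (6 +_) (trans (length-map π (complement t)) complement-length) ⟩
      6 + (suc h + (suc (p * 2) * h + (suc h + suc (p * 2) * 4)))
                                              ≡⟨ count h p ⟩
      (3 + p * 2) * n                         ≡⟨ cong (_* n) (sym m≡3+2p) ⟩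
      m * n                                   ∎
      where
      open ≡-Reasoning
      count : ∀ h p → 6 + (suc h + (suc (p * 2) * h + (suc h + suc (p * 2) * 4))) ≡ (3 + p * 2) * (4 + h)
      count = solve-∀

    factor-unique : Unique (C₁ ++ C₂)
    factor-unique = covering⇒unique (C₁ ++ C₂) factor-covers factor-length

    hexagon-separates : 2 ∣ t → ∀ {u v} → u ∈ C₁ → v ∉ C₁ → TwoCycleFactorSeparating Adj u v
    hexagon-separates even {u} {v} u∈ v∉ = C₁ , C₂ ,
      closed (image π adjacent (hexagon-path s-odd)) (adjacent (E-sym (across s-odd refl))) (s≤s (s≤s (s≤s z≤n)))
        (proj₁ (Unique-++⁻ C₁ factor-unique)) ,
      closed (image π adjacent (complement-path even)) (adjacent (complement-closes even)) long (proj₂ (Unique-++⁻ C₁ factor-unique)) ,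
      factor-unique , factor-covers , u∈ , [ (λ v∈ → ⊥-elim (v∉ v∈)) , (λ v∈ → v∈) ]′ (∈-++⁻ C₁ (factor-covers v))
      where
      s-odd : 2 ∣ suc s
      s-odd = top-odd even (∣m∣n⇒∣m+n ∣-refl 2∣h)
      long : 3 ≤ length C₂
      long = subst (3 ≤_) (sym (trans (length-map π (complement t)) complement-length))
        (≤-trans (s≤s (s≤s (s≤s z≤n))) (≤-trans (m≤n+m _ (suc h)) (+-monoʳ-≤ (suc h) (≤-trans (m≤n+m _ (suc h)) (m≤n+m _ (suc (p * 2) * h))))))

  -- Choosing a hexagon that contains exactly one of two vertices

  _∈?_ : (v : Vertex m n) (L : List (Vertex m n)) → Dec (v ∈ L)
  _∈?_ = DecMembership._∈?_ (≡-dec Fin._≟_ Fin._≟_)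

  below : ∀ {c r} → c < m → r < n → c + r * m < m * n
  below {c} {r} c<m r<n = begin-strict
    c + r * m  <⟨ +-monoˡ-< (r * m) c<m ⟩
    suc r * m  ≤⟨ *-monoˡ-≤ m r<n ⟩
    n * m      ≡⟨ *-comm n m ⟩
    m * n      ∎
    where open ≤-Reasoning

  2<m : 2 < m
  2<m = subst (2 <_) (sym m≡3+2p) (s≤s (s≤s (s≤s z≤n)))

  -- The hexagon lies above `t`, so its numbers are matched with `x` one full period higher; this
  -- avoids subtraction.
  ∈-C₁ : ∀ t {x c r} → c < 2 → r < 3 → x + 1 * (m * n) ≡ s t + (c + r * m) → π x ∈ C₁ t
  ∈-C₁ t {x} c<2 r<3 eq = subst (_∈ C₁ t) (trans (cong π (sym eq)) (π-periodic x 1)) (∈-map⁺ π (hexagon-∈ (s t) c<2 r<3))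

  -- Coordinates relative to a free origin `b` allow two hexagons to be compared. As `k` and `r` are
  -- at most 2, the row is at most 4, and `n ≥ 5` excludes wrapping around.
  ∈-C₁⁻ : ∀ t b k {e} → k < 3 → s t ≡ b + k * m → e < m * n → π (b + e) ∈ C₁ t →
    ∃₂ λ c r → c < 2 × r < 3 × e ≡ c + (k + r) * m
  ∈-C₁⁻ t b k {e} k<3 s≡ e<N v∈ with ∈-map⁻ π v∈
  ... | x , x∈ , eq with hexagon-∈⁻ (s t) x∈
  ...   | c , r , c<2 , r<3 , refl = c , r , c<2 , r<3 ,
    π-injective b e<N (below (<-trans c<2 2<m)
        (≤-trans (s≤s (+-mono-≤ (s≤s⁻¹ k<3) (s≤s⁻¹ r<3))) (m≤m+n 5 h′)))
      (trans eq (cong π (trans (cong (_+ (c + r * m)) s≡) (identity b k c r m))))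
    where
    identity : ∀ b k c r m → b + k * m + (c + r * m) ≡ b + (c + (k + r) * m)
    identity = solve-∀

  -- Two of the hexagons through the edge meet only in its ends.
  separate-from-edge : ∀ {z} {v : Vertex m n} → 2 ∣ suc z → (∀ {c} → c < 2 → v ≢ π (z + c)) →
    ∀ {c} → c < 2 → TwoCycleFactorSeparating Adj (π (z + c)) v
  separate-from-edge {z} {v} odd v≢ {c} c<2 with v ∈? C₁ (z + 3 * m) | v ∈? C₁ (z + 1 * m)
  -- This hexagon starts at `z` modulo `m * n` and has the edge as its bottom.
  ... | no v∉ | _ = hexagon-separates (z + 3 * m) even (∈-C₁ (z + 3 * m) c<2 (s≤s z≤n) (identity z c m h)) v∉
    where
    even : 2 ∣ z + 3 * m
    even = ∣m+n∣m⇒∣n (subst (2 ∣_) (shuffle z m) (∣m∣n⇒∣m+n odd (∣m∣n⇒∣m+n 2∣1+m (∣m⇒∣m*n m ∣-refl)))) ∣-refl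
      where
      shuffle : ∀ z m → suc z + (suc m + 2 * m) ≡ 2 + (z + 3 * m)
      shuffle = solve-∀
    identity : ∀ z c m h → z + c + 1 * (m * (4 + h)) ≡ z + 3 * m + suc h * m + (c + 0 * m)
    identity = solve-∀
  -- This one starts two rows below `z` and has the edge as its top.
  ... | yes _ | no v∉ = hexagon-separates (z + 1 * m) even (∈-C₁ (z + 1 * m) c<2 ≤-refl (identity z c m h)) v∉
    where
    even : 2 ∣ z + 1 * m
    even = ∣m+n∣m⇒∣n (subst (2 ∣_) (shuffle z m) (∣m∣n⇒∣m+n odd 2∣1+m)) ∣-refl
      where
      shuffle : ∀ z m → suc z + suc m ≡ 2 + (z + 1 * m)
      shuffle = solve-∀
    identity : ∀ z c m h → z + c + 1 * (m * (4 + h)) ≡ z + 1 * m + suc h * m + (c + 2 * m)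
    identity = solve-∀
  -- Counted from two rows below `z`, the hexagons take rows 2 to 4 and rows 0 to 2. A common vertex
  -- lies in row 2, hence on the edge.
  ... | yes v∈ | yes v∈′ with π-surjective (z + (2 + h) * m) v
  ...   | e , e<N , refl with ∈-C₁⁻ (z + 3 * m) (z + (2 + h) * m) 2 ≤-refl (identity z m h) e<N v∈
                            | ∈-C₁⁻ (z + 1 * m) (z + (2 + h) * m) 0 (s≤s z≤n) (identity′ z m h) e<N v∈′
    where
    identity : ∀ z m h → z + 3 * m + suc h * m ≡ z + (2 + h) * m + 2 * m
    identity = solve-∀
    identity′ : ∀ z m h → z + 1 * m + suc h * m ≡ z + (2 + h) * m + 0 * m
    identity′ = solve-∀
  ...     | d , r , d<2 , _ , refl | d′ , r′ , d′<2 , r′<3 , eq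
    with digits-unique (2 + r) r′ (<-trans d<2 2<m) (<-trans d′<2 2<m) eq
  ...       | refl , refl with r | r′<3
  ...         | zero  | _ = ⊥-elim (v≢ d<2 (trans (cong π (identity z d m h)) (π-periodic (z + d) 1)))
    where
    identity : ∀ z d m h → z + (2 + h) * m + (d + 2 * m) ≡ z + d + 1 * (m * (4 + h))
    identity = solve-∀
  ...         | suc _ | s≤s (s≤s (s≤s ()))

  -- The hexagon on the left of `suc z`, in columns `z` and `suc z`, has `suc z` in the middle of
  -- its right side and misses column `suc z + 1`.
  separate-edge : ∀ {z} → 2 ∣ z → TwoCycleFactorSeparating Adj (π (suc z + 0)) (π (suc z + 1))
  separate-edge {z} even = hexagon-separates t (∣m∣n⇒∣m+n even (∣m⇒∣m*n m ∣-refl))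
    (∈-C₁ t (s≤s (s≤s z≤n)) (s≤s (s≤s z≤n)) (identity z m h)) v∉
    where
    t : ℕ
    t = z + 2 * m
    identity : ∀ z m h → suc z + 0 + 1 * (m * (4 + h)) ≡ z + 2 * m + suc h * m + (1 + 1 * m)
    identity = solve-∀
    identity′ : ∀ z m h → z + 2 * m + suc h * m + (2 + 1 * m) ≡ suc z + 1 + 1 * (m * (4 + h))
    identity′ = solve-∀
    v∉ : π (suc z + 1) ∉ C₁ t
    v∉ v∈ with ∈-C₁⁻ t (s t) 0 (s≤s z≤n) (sym (+-identityʳ (s t))) (below 2<m (s≤s (s≤s z≤n)))
                 (subst (_∈ C₁ t) (sym (trans (cong π (identity′ z m h)) (π-periodic (suc z + 1) 1))) v∈)
    ... | c , r , c<2 , _ , eq with digits-unique 1 r 2<m (<-trans c<2 2<m) eq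
    ...   | refl , _ = <-irrefl refl c<2

  separate : ∀ {z c} {v : Vertex m n} → 2 ∣ z → c < 2 → π (suc z + c) ≢ v →
    TwoCycleFactorSeparating Adj (π (suc z + c)) v
  separate {z} {c} {v} even c<2 u≢v with ≡-dec Fin._≟_ Fin._≟_ v (π (suc z + 0)) | ≡-dec Fin._≟_ Fin._≟_ v (π (suc z + 1))
  separate {c = suc (suc _)} _ (s≤s (s≤s ())) _ | _ | _
  separate {z} {zero} even _ u≢v | yes refl | _ = ⊥-elim (u≢v refl)
  separate {z} {suc zero} even _ u≢v | yes refl | _ = separating-sym (separate-edge even)
  separate {z} {zero} even _ u≢v | no _ | yes refl = separate-edge even
  separate {z} {suc zero} even _ u≢v | no _ | yes refl = ⊥-elim (u≢v refl)
  separate {z} {c} {v} even c<2 u≢v | no v≢₀ | no v≢₁ = separate-from-edge (∣m∣n⇒∣m+n ∣-refl even) v≢ c<2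
    where
    v≢ : ∀ {d} → d < 2 → v ≢ π (suc z + d)
    v≢ {zero}        _ = v≢₀
    v≢ {suc zero}    _ = v≢₁
    v≢ {suc (suc _)} (s≤s (s≤s ()))

  cyclable : TwoSpanningCyclable Adj
  -- Counting from 1 gives `u` a positive representative, so it can be written as `suc z + c` with
  -- `z` even and `c < 2`.
  cyclable u v u≢v with π-surjective 1 u
  ... | e , _ , refl with even-or-odd e
  ...   | inj₁ even = subst (λ a → TwoCycleFactorSeparating Adj (π a) v) (+-identityʳ (suc e))
    (separate even (s≤s z≤n) (u≢v ∘ trans (cong π (sym (+-identityʳ (suc e))))))
  cyclable u v u≢v | suc e , _ , refl | inj₂ odd = subst (λ a → TwoCycleFactorSeparating Adj (π a) v) (+-comm (suc e) 1)
    (separate (∣m+n∣m⇒∣n odd ∣-refl) ≤-refl (u≢v ∘ trans (cong π (+-comm 1 (suc e)))))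
  cyclable u v u≢v | zero , _ , refl | inj₂ odd = ⊥-elim (∣⇒∤suc ≤-refl (2 ∣0) odd)

-- Necessity: cycles forced by few neighbours

mod⇒%≡ : ∀ {a b} n .{{_ : NonZero n}} → a ≡ b [mod n ] → a % n ≡ b % n
mod⇒%≡ {b = b} n (k , inj₁ refl) = [m+kn]%n≡m%n b k n
mod⇒%≡ {a}     n (k , inj₂ refl) = sym ([m+kn]%n≡m%n a k n)

module _ {A : Set} {R : A → A → Set} (R-sym : ∀ {x y} → R x y → R y x) where

  private
    end : ∀ {x y : A} P → Linked R (x ∷ P ++ [ y ]) → R x y ⊎ (∃ λ p → p ∈ P × R x p)
    end []      (r ∷ _) = inj₁ r
    end (p ∷ P) (r ∷ _) = inj₂ (p , here refl , r)

    no-three : ∀ {a b x y z : A} → x ≡ a ⊎ x ≡ b → y ≡ a ⊎ y ≡ b → z ≡ a ⊎ z ≡ b →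
               x ≢ y → x ≢ z → y ≢ z → ⊥
    no-three (inj₁ refl) (inj₁ refl) _           x≢y _   _   = x≢y refl
    no-three (inj₁ refl) (inj₂ refl) (inj₁ refl) _   x≢z _   = x≢z refl
    no-three (inj₁ refl) (inj₂ refl) (inj₂ refl) _   _   y≢z = y≢z refl
    no-three (inj₂ refl) (inj₁ refl) (inj₁ refl) _   _   y≢z = y≢z refl
    no-three (inj₂ refl) (inj₁ refl) (inj₂ refl) _   x≢z _   = x≢z refl
    no-three (inj₂ refl) (inj₂ refl) _           x≢y _   _   = x≢y refl

    -- The first and the last vertex of the arc lie in `{a , b}`, and `q` outside the arc occupies
    -- one of these two values; so the first and the last vertex coincide.
    single : ∀ {x y a b q : A} P → Linked R (x ∷ P ++ [ y ]) → Unique P → q ∉ P → q ≡ a ⊎ q ≡ b →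
      (∀ {p} → p ∈ P → R x p → p ≡ a ⊎ p ≡ b) → (∀ {p} → p ∈ P → R y p → p ≡ a ⊎ p ≡ b) →
      ∀ {p} → p ∈ P → p ≡ a ⊎ p ≡ b
    single (p ∷ P) (r ∷ l) (p∉ ∷ _) q∉ q nx ny with initLast P
    ... | []      = λ { (here refl) → nx (here refl) r }
    ... | K ∷ʳ′ k = ⊥-elim (no-three (nx (here refl) r) (ny (there k∈) (R-sym last-step)) q
        (All.lookup p∉ k∈) (λ { refl → q∉ (here refl) }) (λ { refl → q∉ (there k∈) }))
      where
      k∈ : k ∈ K ++ [ k ]
      k∈ = ∈-++⁺ʳ K (here refl)
      last-step : R k _
      last-step = Linked-last (p ∷ K) (subst (λ L → Linked R (p ∷ L)) (++-assoc K [ k ] _) l)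

  -- An arc of the cycle between u and w starts and ends in {a , b}; as the other arc needs an end
  -- of its own, each arc is a single vertex.
  two-arcs : ∀ {C u w a b} → IsCycle R C → u ∈ C → w ∈ C → u ≢ w → w ≢ a → w ≢ b →
    (∀ {y} → y ∈ C → R u y → y ≡ a ⊎ y ≡ b) → (∀ {y} → y ∈ C → R w y → y ≡ a ⊎ y ≡ b) →
    ∀ {y} → y ∈ C → (y ≡ u ⊎ y ≡ w) ⊎ (y ≡ a ⊎ y ≡ b)
  two-arcs {C} {u} {w} {a} {b} cyc u∈ w∈ u≢w w≢a w≢b nu nw y∈
    with rotate {R = R} cyc u∈
  ... | D , (_ , uniq , link) , perm with ∈-resp-↭ perm w∈
  ...   | here w≡u = ⊥-elim (u≢w (sym w≡u))
  ...   | there w∈D with ∈-∃++ w∈D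
  ...     | P , Q , refl with Linked-split (u ∷ P) (subst (λ L → Linked R (u ∷ L)) (++-assoc P (w ∷ Q) [ u ]) link)
  ...       | arc₁ , arc₂ with end P arc₁ | end Q arc₂
  ...         | inj₁ r | _ = ⊥-elim ([ w≢a , w≢b ]′ (nu w∈ r))
  ...         | inj₂ _ | inj₁ r = ⊥-elim ([ w≢a , w≢b ]′ (nu w∈ (R-sym r)))
  ...         | inj₂ (p , p∈ , rp) | inj₂ (q , q∈ , rq) = place (∈-resp-↭ perm y∈)
    where
    uniq-D : Unique (P ++ w ∷ Q)
    uniq-D = proj₂ (Unique-++⁻ [ u ] uniq)
    disjoint : ∀ {z} → z ∈ P → z ∉ Q
    disjoint z∈P z∈Q = Unique-++-disjoint P uniq-D z∈P (there z∈Q)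
    inP : ∀ {z} → z ∈ P → z ∈ C
    inP z∈ = ∈-resp-↭ (↭-sym perm) (there (∈-++⁺ˡ z∈))
    inQ : ∀ {z} → z ∈ Q → z ∈ C
    inQ z∈ = ∈-resp-↭ (↭-sym perm) (there (∈-++⁺ʳ P (there z∈)))
    uniq-Q : Unique Q
    uniq-Q = proj₂ (Unique-++⁻ [ w ] (proj₂ (Unique-++⁻ P uniq-D)))
    place : ∀ {y} → y ∈ u ∷ P ++ w ∷ Q → (y ≡ u ⊎ y ≡ w) ⊎ (y ≡ a ⊎ y ≡ b)
    place (here eq) = inj₁ (inj₁ eq)
    place (there y∈) with ∈-++⁻ P y∈
    ... | inj₁ y∈P = inj₂ (single P arc₁ (proj₁ (Unique-++⁻ P uniq-D)) (λ q∈P → disjoint q∈P q∈)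
      (nw (inQ q∈) rq) (nu ∘ inP) (nw ∘ inP) y∈P)
    ... | inj₂ (here eq) = inj₁ (inj₂ eq)
    ... | inj₂ (there y∈Q) = inj₂ (single Q arc₂ uniq-Q (disjoint p∈)
      (nu (inP p∈) rp) (nw ∘ inQ) (nu ∘ inQ) y∈Q)

module _ {A : Set} {R : A → A → Set} (R-sym : ∀ {x y} → R x y → R y x)
         {C D : List A} (cC : IsCycle R C) (cD : IsCycle R D)
         (disjoint : ∀ {z} → z ∈ C → z ∉ D) (covers : ∀ z → z ∈ C ⊎ z ∈ D) where

  -- With `x′` on `D`, the cycle `C` must pass through `x` by way of `a` and `b`. Were `y` on `D`,
  -- only `y′` would be left as its neighbour there, and it needs two.
  opposite-∈ : ∀ {x y a b x′ y′} →
    (∀ {z} → R x z → (z ≡ a ⊎ z ≡ b) ⊎ z ≡ x′) → (∀ {z} → R y z → (z ≡ a ⊎ z ≡ b) ⊎ z ≡ y′) →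
    x ∈ C → x′ ∈ D → y ∈ C
  opposite-∈ {x} {y} {a} {b} {x′} {y′} nx ny x∈C x′∈D with covers y
  ... | inj₁ y∈C = y∈C
  ... | inj₂ y∈D with two-neighbours R-sym cC x∈C | two-neighbours R-sym cD y∈D
  ...   | p , q , p≢q , (p∈C , rp) , (q∈C , rq) | p′ , q′ , p′≢q′ , (p′∈D , rp′) , (q′∈D , rq′) =
    ⊥-elim (p′≢q′ (trans (only p′∈D (ny rp′)) (sym (only q′∈D (ny rq′)))))
    where
    inner : ∀ {z} → z ∈ C → (z ≡ a ⊎ z ≡ b) ⊎ z ≡ x′ → z ≡ a ⊎ z ≡ b
    inner z∈C (inj₁ e)    = e
    inner z∈C (inj₂ refl) = ⊥-elim (disjoint z∈C x′∈D)
    both : p ≡ a ⊎ p ≡ b → q ≡ a ⊎ q ≡ b → a ∈ C × b ∈ C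
    both (inj₁ refl) (inj₁ refl) = ⊥-elim (p≢q refl)
    both (inj₁ refl) (inj₂ refl) = p∈C , q∈C
    both (inj₂ refl) (inj₁ refl) = q∈C , p∈C
    both (inj₂ refl) (inj₂ refl) = ⊥-elim (p≢q refl)
    ab∈C : a ∈ C × b ∈ C
    ab∈C = both (inner p∈C (nx rp)) (inner q∈C (nx rq))
    only : ∀ {z} → z ∈ D → (z ≡ a ⊎ z ≡ b) ⊎ z ≡ y′ → z ≡ y′
    only z∈D (inj₁ (inj₁ refl)) = ⊥-elim (disjoint (proj₁ ab∈C) z∈D)
    only z∈D (inj₁ (inj₂ refl)) = ⊥-elim (disjoint (proj₂ ab∈C) z∈D)
    only z∈D (inj₂ e)           = e

-- One column

cycle-graph-neighbours : ∀ {n i j} → HTGAdj 1 (2 + n) 1 (0F , 0F) (i , j) →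
  j ≡ 1F ⊎ suc (toℕ j) ≡ 2 + n
cycle-graph-neighbours {n} {0F} {j} (_ , e) = edge e
  where
  above : (0 + 1) ≡ toℕ j [mod 2 + n ] → j ≡ 1F
  above c = Fin.toℕ-injective (trans (sym (m<n⇒m%n≡m (Fin.toℕ<n j)))
    (sym (mod⇒%≡ {1} (2 + n) c)))
  below : (toℕ j + 1) ≡ 0 [mod 2 + n ] → suc (toℕ j) ≡ 2 + n
  below c = ≤-antisym (Fin.toℕ<n j)
    (∣⇒≤ (subst (2 + n ∣_) (+-comm (toℕ j) 1) (m%n≡0⇒n∣m _ (2 + n) (mod⇒%≡ {b = 0} (2 + n) c))))
  edge : HTGEdge 1 (2 + n) 1 (0F , 0F) (0F , j) ⊎ HTGEdge 1 (2 + n) 1 (0F , j) (0F , 0F) → _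
  edge (inj₁ (vertical c))     = inj₁ (above c)
  -- For `m = 1` and `ℓ = 1` a jump edge joins consecutive rows, as a vertical edge does.
  edge (inj₁ (jump _ _ _ c))   = inj₁ (above c)
  edge (inj₂ (vertical c))     = inj₂ (below c)
  edge (inj₂ (jump _ _ _ c))   = inj₂ (below c)

-- Row 0 has only row 1 and the last row as neighbours. Separated from row 1, it keeps a single
-- neighbour on its cycle.
one-column-not-cyclable : ∀ n → ¬ TwoSpanningCyclable (HTGAdj 1 (2 + n) 1)
one-column-not-cyclable n cyclable with cyclable (0F , 0F) (0F , 1F) (λ ())
... | C , D , cC , cD , uniq , _ , u∈ , v∈ with two-neighbours HTGAdj-sym cC u∈
...   | (0F , a) , (0F , b) , a≢b , (a∈ , ra) , (b∈ , rb) =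
  a≢b (cong (0F ,_) (Fin.toℕ-injective (suc-injective (trans (last a∈ ra) (sym (last b∈ rb))))))
  where
  last : ∀ {j} → (0F , j) ∈ C → HTGAdj 1 (2 + n) 1 (0F , 0F) (0F , j) → suc (toℕ j) ≡ 2 + n
  last j∈ r with cycle-graph-neighbours r
  ... | inj₁ refl = ⊥-elim (Unique-++-disjoint C uniq j∈ v∈)
  ... | inj₂ eq   = eq

-- Four rows

module FourRows (k : ℕ) (odd-m : ¬ 2 ∣ 3 + k) where

  Adj : Vertex (3 + k) 4 → Vertex (3 + k) 4 → Set
  Adj = HTGAdj (3 + k) 4 1

  Odd Even : Fin 4 → Set
  Odd  j = j ≡ 1F ⊎ j ≡ 3F
  Even j = j ≡ 0F ⊎ j ≡ 2F

  next-to-odd : ∀ {j j′} → Odd j → (toℕ j + 1) ≡ toℕ j′ [mod 4 ] ⊎ (toℕ j′ + 1) ≡ toℕ j [mod 4 ] → Even j′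
  next-to-odd {j′ = 0F} _ _ = inj₁ refl
  next-to-odd {j′ = 2F} _ _ = inj₂ refl
  next-to-odd {j′ = 1F} (inj₁ refl) c with mod⇒%≡ {2} {1} 4 (reduce c)
  ... | ()
  next-to-odd {j′ = 1F} (inj₂ refl) (inj₁ c) with mod⇒%≡ {4} {1} 4 c
  ... | ()
  next-to-odd {j′ = 1F} (inj₂ refl) (inj₂ c) with mod⇒%≡ {2} {3} 4 c
  ... | ()
  next-to-odd {j′ = 3F} (inj₁ refl) (inj₁ c) with mod⇒%≡ {2} {3} 4 c
  ... | ()
  next-to-odd {j′ = 3F} (inj₁ refl) (inj₂ c) with mod⇒%≡ {4} {1} 4 c
  ... | ()
  next-to-odd {j′ = 3F} (inj₂ refl) c with mod⇒%≡ {4} {3} 4 (reduce c)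
  ... | ()

  -- With four rows, both odd-row vertices of a column have the same two vertical neighbours, in
  -- rows 0 and 2; the third neighbour is in column `i′`.
  Near : Fin (3 + k) → Fin (3 + k) → Fin 4 → Vertex (3 + k) 4 → Set
  Near i i′ j y = (y ≡ (i , 0F) ⊎ y ≡ (i , 2F)) ⊎ y ≡ (i′ , j)

  in-column : ∀ {i i′ j j′} → Even j′ → Near i i′ j (i , j′)
  in-column (inj₁ refl) = inj₁ (inj₁ refl)
  in-column (inj₂ refl) = inj₁ (inj₂ refl)

  even-∣ : ∀ {j} → Even j → 2 ∣ toℕ j
  even-∣ (inj₁ refl) = 2 ∣0
  even-∣ (inj₂ refl) = ∣-refl

  odd-∣ : ∀ {j} → Odd j → 2 ∣ suc (toℕ j)
  odd-∣ (inj₁ refl) = ∣-refl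
  odd-∣ (inj₂ refl) = n∣m*n 2

  near₀ : ∀ {j y} → Odd j → Adj (0F , j) y → Near 0F 1F j y
  near₀ o (_ , inj₁ (vertical c))   = in-column (next-to-odd o (inj₁ c))
  near₀ o (_ , inj₁ (flat e _))     = inj₂ (cong (_, _) (sym (Fin.toℕ-injective {i = 1F} e)))
  near₀ o (_ , inj₂ (vertical c))   = in-column (next-to-odd o (inj₂ c))
  -- A jump into an odd row would start in an even row, and the jump condition would then make `m`
  -- even.
  near₀ o (_ , inj₂ (jump _ _ d c)) =
    ⊥-elim (odd-m (∣m+n∣m⇒∣n d (even-∣ (next-to-odd o (inj₂ c)))))

  near₁ : ∀ {j y} → Odd j → Adj (1F , j) y → Near 1F 0F j y
  near₁ o (_ , inj₁ (vertical c)) = in-column (next-to-odd o (inj₁ c))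
  near₁ o (_ , inj₁ (flat _ d))   = ⊥-elim (d (odd-∣ o))
  near₁ o (_ , inj₂ (vertical c)) = in-column (next-to-odd o (inj₂ c))
  near₁ o (_ , inj₂ (flat e _))   = inj₂ (cong (_, _) (Fin.toℕ-injective {j = 0F} (suc-injective e)))

  not-cyclable : ¬ TwoSpanningCyclable Adj
  not-cyclable cyclable with cyclable (0F , 1F) (1F , 1F) (λ ())
  ... | C , D , cC , cD , uniq , cov , u∈C , v∈D = absurd
    where
    covers : ∀ z → z ∈ C ⊎ z ∈ D
    covers z = ∈-++⁻ C (cov z)
    disjoint : ∀ {z} → z ∈ C → z ∉ D
    disjoint = Unique-++-disjoint C uniq
    -- `(0F , 3F)` shares its vertical neighbours with `(0F , 1F)`, whose flat neighbour is on `D`;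
    -- so it follows onto `C`.
    w∈C : (0F , 3F) ∈ C
    w∈C = opposite-∈ HTGAdj-sym cC cD disjoint covers (near₀ (inj₁ refl)) (near₀ (inj₂ refl)) u∈C v∈D
    w′∈D : (1F , 3F) ∈ D
    w′∈D = opposite-∈ HTGAdj-sym cD cC (λ z∈D z∈C → disjoint z∈C z∈D) (swap ∘ covers)
      (near₁ (inj₁ refl)) (near₁ (inj₂ refl)) v∈D u∈C
    inside : ∀ {i i′ j L} → (i′ , j) ∉ L → ∀ {y} → y ∈ L → Near i i′ j y → y ≡ (i , 0F) ⊎ y ≡ (i , 2F)
    inside ∉L y∈L (inj₁ e)    = e
    inside ∉L y∈L (inj₂ refl) = ⊥-elim (∉L y∈L)
    -- The flat neighbours of both odd-row vertices are on `D`, so on `C` these two vertices meet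
    -- only rows 0 and 2 of column 0, and `C` closes up there.
    column₀ : ∀ {y} → y ∈ C → (y ≡ (0F , 1F) ⊎ y ≡ (0F , 3F)) ⊎ (y ≡ (0F , 0F) ⊎ y ≡ (0F , 2F))
    column₀ = two-arcs HTGAdj-sym cC u∈C w∈C (λ ()) (λ ()) (λ ())
      (λ y∈ r → inside (λ z∈ → disjoint z∈ v∈D) y∈ (near₀ (inj₁ refl) r))
      (λ y∈ r → inside (λ z∈ → disjoint z∈ w′∈D) y∈ (near₀ (inj₂ refl) r))
    column₁ : ∀ {y} → y ∈ D → (y ≡ (1F , 1F) ⊎ y ≡ (1F , 3F)) ⊎ (y ≡ (1F , 0F) ⊎ y ≡ (1F , 2F))
    column₁ = two-arcs HTGAdj-sym cD v∈D w′∈D (λ ()) (λ ()) (λ ())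
      (λ y∈ r → inside (disjoint u∈C) y∈ (near₁ (inj₁ refl) r))
      (λ y∈ r → inside (disjoint w∈C) y∈ (near₁ (inj₂ refl) r))
    absurd : ⊥
    -- Column 2 exists because `m ≥ 3`, and neither cycle reaches it.
    absurd with covers (2F , 0F)
    ... | inj₁ z∈ with column₀ z∈
    ...   | inj₁ (inj₁ ())
    ...   | inj₁ (inj₂ ())
    ...   | inj₂ (inj₁ ())
    ...   | inj₂ (inj₂ ())
    absurd | inj₂ z∈ with column₁ z∈
    ...   | inj₁ (inj₁ ())
    ...   | inj₁ (inj₂ ())
    ...   | inj₂ (inj₁ ())
    ...   | inj₂ (inj₂ ())

-- Assembling the equivalence

at-least-three-columns : ∀ m n → 1 ≤ m → ¬ 2 ∣ m → 4 ≤ n → TwoSpanningCyclable (HTGAdj m n 1) → 3 ≤ m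
at-least-three-columns 1 (suc (suc n)) _ _ _ cyclable = ⊥-elim (one-column-not-cyclable n cyclable)
at-least-three-columns 1 1 _ _ (s≤s ()) _
at-least-three-columns 2 _ _ odd-m _ _ = ⊥-elim (odd-m ∣-refl)
at-least-three-columns (suc (suc (suc _))) _ _ _ _ _ = s≤s (s≤s (s≤s z≤n))

more-than-four-rows : ∀ m n → 3 ≤ m → ¬ 2 ∣ m → 4 ≤ n → TwoSpanningCyclable (HTGAdj m n 1) → 4 < n
more-than-four-rows (suc (suc (suc k))) n (s≤s (s≤s (s≤s z≤n))) odd-m 4≤n cyclable with m≤n⇒m<n∨m≡n 4≤n
... | inj₁ 4<n  = 4<n
... | inj₂ refl = ⊥-elim (FourRows.not-cyclable k odd-m cyclable)

large-cyclable : ∀ m n → ¬ 2 ∣ m → 2 ∣ n → 3 ≤ m → 4 < n → TwoSpanningCyclable (HTGAdj m n 1)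
large-cyclable (suc (suc (suc k))) (suc (suc (suc (suc (suc r))))) odd-m 2∣n _ _ with even-or-odd (3 + k)
... | inj₁ 2∣m = ⊥-elim (odd-m 2∣m)
... | inj₂ 2∣1+m with ∣m+n∣m⇒∣n 2∣1+m (n∣m*n 2)
-- Here `n = 5 + r`, so `h` is `suc r`, even because `n` is; likewise `k = p * 2` because `m` is
-- odd.
...   | divides p eq = Factors.cyclable (3 + k) p r (cong (3 +_) eq) (∣m+n∣m⇒∣n 2∣n (n∣m*n 2))
large-cyclable (suc (suc (suc _))) 0 _ _ _ ()
large-cyclable (suc (suc (suc _))) 1 _ _ _ (s≤s ())
large-cyclable (suc (suc (suc _))) 2 _ _ _ (s≤s (s≤s ()))
large-cyclable (suc (suc (suc _))) 3 _ _ _ (s≤s (s≤s (s≤s ())))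
large-cyclable (suc (suc (suc _))) 4 _ _ _ (s≤s (s≤s (s≤s (s≤s ()))))
large-cyclable 1 _ _ _ (s≤s ()) _
large-cyclable 2 _ _ _ (s≤s (s≤s ())) _

theorem4p1 : (m n : ℕ) → 1 ≤ m → ¬ (2 ∣ m) → 4 ≤ n → 2 ∣ n →
    (TwoSpanningCyclable (HTGAdj m n 1) ⇔ (3 ≤ m × 4 < n))
theorem4p1 m n 1≤m odd-m 4≤n 2∣n = mk⇔
  (λ cyclable → let 3≤m = at-least-three-columns m n 1≤m odd-m 4≤n cyclable in
    3≤m , more-than-four-rows m n 3≤m odd-m 4≤n cyclable)
  (λ { (3≤m , 4<n) → large-cyclable m n odd-m 2∣n 3≤m 4<n })
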